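{- For every $d\ge 3$, every $d$-regular graph on $n$ vertices has a total vertex cover on at most $\frac{d}{d+1}\cdot n$ vertices. For $d\ge 5$, every connected $d$-regular graph on $n$ vertices distinct from $K_{d+1}$ has a total vertex cover on at most $\frac{d-\epsilon}{d+1}\cdot n$ vertices, with $\epsilon=\frac{1}{2d+1}$.
   Context: A total vertex cover of a graph $G$ is a set $S\subseteq V(G)$ that is both a vertex cover (every edge has an endpoint in $S$) and a total dominating set (every vertex of $G$ has a neighbor in $S$). -}

module Defs where

open import Data.Nat using (ℕ; suc)
open import Data.Bool using (Bool; true; false; T)
open import Data.Fin using (Fin)
open import Data.Fin.Subset using (Subset; _∈_; ∣_∣)
open import Data.Vec using (Vec; tabulate; count)
open import Data.Vec.Functional using () 
open import Data.Product using (Σ; _×_; ∃-syntax)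
open import Data.Sum using (_⊎_)
open import Relation.Binary.PropositionalEquality using (_≡_; _≢_)
open import Relation.Nullary using (¬_)
open import Data.Empty using (⊥)

record Graph (n : ℕ) : Set where
  field
    adj   : Fin n → Fin n → Bool
    sym   : ∀ u v → adj u v ≡ adj v u
    irrefl : ∀ u → adj u u ≡ false

open Graph public

Adj : ∀ {n} → Graph n → Fin n → Fin n → Set
Adj G u v = T (adj G u v)

nbhd : ∀ {n} → Graph n → Fin n → Subset n
nbhd G v = tabulate (λ u → adj G v u)

degree : ∀ {n} → Graph n → Fin n → ℕ
degree G v = ∣ nbhd G v ∣

Regular : ∀ {n} → ℕ → Graph n → Set
Regular d G = ∀ v → degree G v ≡ d

IsVertexCover : ∀ {n} → Graph n → Subset n → Set
IsVertexCover G S = ∀ u v → Adj G u v → (u ∈ S) ⊎ (v ∈ S)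

IsTotalDominating : ∀ {n} → Graph n → Subset n → Set
IsTotalDominating G S = ∀ v → ∃[ u ] (Adj G v u × u ∈ S)

IsTotalVertexCover : ∀ {n} → Graph n → Subset n → Set
IsTotalVertexCover G S = IsVertexCover G S × IsTotalDominating G S

data Reachable {n} (G : Graph n) : Fin n → Fin n → Set where
  here : ∀ {v} → Reachable G v v
  step : ∀ {u v w} → Adj G u v → Reachable G v w → Reachable G u w

Connected : ∀ {n} → Graph n → Set
Connected G = ∀ u v → Reachable G u v

IsComplete : ∀ {n} → Graph n → Set
IsComplete G = ∀ u v → u ≢ v → Adj G u v

IsK : ∀ {n} → ℕ → Graph n → Set
IsK {n} m G = (n ≡ m) × IsComplete G

{-# OPTIONS --safe #-}
module Submission where

-- The complement I of a total vertex cover is an independent set containing no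
-- whole neighbourhood.  Let k x be the number of neighbours of x in I, so k x < d,
-- and take I maximal.  Then every undominated w ∉ I (one with k w = 0) has a
-- neighbour v with k v = d ∸ 1, and w is the only neighbour of v outside I.  In the
-- double count d ∣I∣ = ∑ k x each dominated vertex pays 1 for itself, and such a v
-- pays 1 more for w; this is affordable for d ≥ 3, whence n ≤ (d + 1) ∣I∣.
--
-- For the second bound, I must also pay 1/2 for each of its own vertices.  This is
-- affordable for d ≥ 5 if every t ∈ I is supported: it has a neighbour x with
-- k x ≥ 2, or a neighbour w which has a neighbour v with k v = d ∸ 1.  Support
-- persists when I grows.  Start from two vertices at distance two and take I
-- maximal among the supported sets.  If an undominated vertex u had no neighbour v
-- with k v = d ∸ 1, then by maximality all neighbours of u would be of the same
-- kind, and by connectedness I would be empty.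

open import Defs
open import Data.Nat using (ℕ; zero; suc; _+_; _*_; _∸_; _≤_; _<_; z≤n; s≤s; _≡ᵇ_; _≤?_; _<?_)
open import Data.Nat.Properties
open import Data.Nat.Tactic.RingSolver using (solve-∀)
open import Data.Bool using (Bool; true; false; T; not; _∧_)
open import Data.Bool.Properties using (T?; T-≡)
open import Data.Fin using (Fin; zero; suc)
open import Data.Fin.Properties using (any?; all?) renaming (_≟_ to _≟ᶠ_)
open import Data.Fin.Subset
  using (Subset; ∣_∣; _∈_; _∉_; _∪_; _∩_; _⊆_; _⊃_; ∁; ⁅_⁆; ⊥)
open import Data.Fin.Subset.Properties
open import Data.Fin.Subset.Induction using (⊃-wellFounded; Acc; acc)
open import Data.Vec using ([]; _∷_; lookup)
open import Data.Vec.Properties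
  using (lookup∘tabulate; lookup-zipWith; []=⇒lookup; lookup⇒[]=)
open import Data.Product using (_×_; ∃-syntax; _,_; proj₁; proj₂)
open import Data.Sum using (_⊎_; inj₁; inj₂; [_,_]′) renaming (map to map-⊎)
open import Data.Unit using (tt)
open import Function using (_∘_; const; Equivalence)
open import Relation.Binary.PropositionalEquality
  using (_≡_; _≢_; refl; trans; cong; cong₂; subst; module ≡-Reasoning)
  renaming (sym to ≡-sym)
open import Relation.Nullary using (¬_; Dec; yes; no; contradiction)
open import Relation.Nullary.Decidable using (_×-dec_; _⊎-dec_; _→-dec_; ¬?; decidable-stable)
open import Algebra.Properties.Semiring.Sum +-*-semiring
  using (sum; sum-syntax; sum-cong-≗; ∑-distrib-+; ∑-comm; *-distribˡ-sum)

private variable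
  n : ℕ

-- Sums, cardinalities of subsets, and extension to a maximal subset.

∑-mono-≤ : ∀ {n} {f g : Fin n → ℕ} → (∀ i → f i ≤ g i) → sum f ≤ sum g
∑-mono-≤ {zero}  f≤g = z≤n
∑-mono-≤ {suc n} f≤g = +-mono-≤ (f≤g zero) (∑-mono-≤ (f≤g ∘ suc))

term≤∑ : ∀ {n} (f : Fin n → ℕ) i → f i ≤ sum f
term≤∑ f zero    = m≤m+n _ _
term≤∑ f (suc i) = ≤-trans (term≤∑ (f ∘ suc) i) (m≤n+m _ _)

⟦_⟧ : Bool → ℕ
⟦ true ⟧  = 1
⟦ false ⟧ = 0

⟦∧⟧ : ∀ b c → ⟦ b ∧ c ⟧ ≡ ⟦ b ⟧ * ⟦ c ⟧
⟦∧⟧ true  c = ≡-sym (*-identityˡ ⟦ c ⟧)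
⟦∧⟧ false c = refl

T⇒⟦⟧≡1 : ∀ {b} → T b → ⟦ b ⟧ ≡ 1
T⇒⟦⟧≡1 {true} _ = refl

∣p∣≡∑ : (p : Subset n) → ∣ p ∣ ≡ ∑[ i < n ] ⟦ lookup p i ⟧
∣p∣≡∑ []          = refl
∣p∣≡∑ (true  ∷ p) = cong suc (∣p∣≡∑ p)
∣p∣≡∑ (false ∷ p) = ∣p∣≡∑ p

∣∁p∣≡∑ : (p : Subset n) → ∣ ∁ p ∣ ≡ ∑[ i < n ] ⟦ not (lookup p i) ⟧
∣∁p∣≡∑ []          = refl
∣∁p∣≡∑ (true  ∷ p) = ∣∁p∣≡∑ p
∣∁p∣≡∑ (false ∷ p) = cong suc (∣∁p∣≡∑ p)

∣p∣+∣∁p∣≡n : (p : Subset n) → ∣ p ∣ + ∣ ∁ p ∣ ≡ n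
∣p∣+∣∁p∣≡n p = trans (cong (∣ p ∣ +_) (∣∁p∣≡n∸∣p∣ p)) (m+[n∸m]≡n (∣p∣≤n p))

∣p∪q∣≤∣p∣+∣q∣ : (p q : Subset n) → ∣ p ∪ q ∣ ≤ ∣ p ∣ + ∣ q ∣
∣p∪q∣≤∣p∣+∣q∣ []          []          = z≤n
∣p∪q∣≤∣p∣+∣q∣ (true  ∷ p) (true  ∷ q) =
  s≤s (≤-trans (∣p∪q∣≤∣p∣+∣q∣ p q) (+-monoʳ-≤ ∣ p ∣ (n≤1+n _)))
∣p∪q∣≤∣p∣+∣q∣ (true  ∷ p) (false ∷ q) = s≤s (∣p∪q∣≤∣p∣+∣q∣ p q)
∣p∪q∣≤∣p∣+∣q∣ (false ∷ p) (true  ∷ q) =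
  ≤-trans (s≤s (∣p∪q∣≤∣p∣+∣q∣ p q)) (≤-reflexive (≡-sym (+-suc ∣ p ∣ ∣ q ∣)))
∣p∪q∣≤∣p∣+∣q∣ (false ∷ p) (false ∷ q) = ∣p∪q∣≤∣p∣+∣q∣ p q

x∈p⇒1≤∣p∣ : ∀ {x : Fin n} {p} → x ∈ p → 1 ≤ ∣ p ∣
x∈p⇒1≤∣p∣ x∈p = ≤-trans (s≤s z≤n) (x∈p⇒∣p-x∣<∣p∣ x∈p)

x≢y∈p⇒2≤∣p∣ : ∀ {x y : Fin n} {p} → x ≢ y → x ∈ p → y ∈ p → 2 ≤ ∣ p ∣
x≢y∈p⇒2≤∣p∣ x≢y x∈p y∈p =
  ≤-trans (s≤s (x∈p⇒1≤∣p∣ (x∈p∧x≢y⇒x∈p-y x∈p x≢y))) (x∈p⇒∣p-x∣<∣p∣ y∈p)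

1≤∣p∣⇒nonempty : (p : Subset n) → 1 ≤ ∣ p ∣ → ∃[ x ] x ∈ p
1≤∣p∣⇒nonempty {n} p 1≤ with nonempty? p
... | yes ne = ne
... | no ¬ne = contradiction 1≤ (<⇒≱ (s≤s (≤-reflexive
  (trans (cong ∣_∣ (Empty-unique ¬ne)) (∣⊥∣≡0 n)))))

module _ (P : Subset n → Set) (P? : ∀ p → Dec (P p)) where

  -- Vertices are inserted while `P` survives; this stops because `⊃` is well-founded on finite
  -- subsets. Maximality is only against single insertions, so `P` need not be monotone.
  extendToMaximal : ∀ p → P p →
    ∃[ q ] (p ⊆ q × P q × (∀ u → u ∉ q → ¬ P (q ∪ ⁅ u ⁆)))
  extendToMaximal p = go p (⊃-wellFounded p)
    where
    go : ∀ p → Acc _⊃_ p → P p →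
      ∃[ q ] (p ⊆ q × P q × (∀ u → u ∉ q → ¬ P (q ∪ ⁅ u ⁆)))
    go p (acc rec) Pp with any? (λ u → ¬? (u ∈? p) ×-dec P? (p ∪ ⁅ u ⁆))
    ... | no ¬ext = p , (λ x∈p → x∈p) , Pp , λ u u∉p Pu → ¬ext (u , u∉p , Pu)
    ... | yes (u , u∉p , Pu)
      with go (p ∪ ⁅ u ⁆)
              (rec (p⊆p∪q ⁅ u ⁆ , u , q⊆p∪q p ⁅ u ⁆ (x∈⁅x⁆ u) , u∉p)) Pu
    ...   | q , p∪u⊆q , rest = q , p∪u⊆q ∘ p⊆p∪q ⁅ u ⁆ , rest

-- Neighbours inside a set, and independent sets.

module _ {n : ℕ} (G : Graph n) where

  Adj-sym : ∀ {u v} → Adj G u v → Adj G v u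
  Adj-sym {u} {v} = subst T (Graph.sym G u v)

  Adj⇒≢ : ∀ {u v} → Adj G u v → u ≢ v
  Adj⇒≢ {u} uu refl = subst T (irrefl G u) uu

  Adj⇒∈nbhd : ∀ {u v} → Adj G u v → v ∈ nbhd G u
  Adj⇒∈nbhd {u} {v} uv = lookup⇒[]= v _
    (trans (lookup∘tabulate (adj G u) v) (Equivalence.to T-≡ uv))

  ∈nbhd⇒Adj : ∀ {u v} → v ∈ nbhd G u → Adj G u v
  ∈nbhd⇒Adj {u} {v} v∈ = Equivalence.from T-≡
    (trans (≡-sym (lookup∘tabulate (adj G u) v)) ([]=⇒lookup v∈))

  nbrsIn : Subset n → Fin n → ℕ
  nbrsIn I x = ∣ nbhd G x ∩ I ∣

  nbrsIn-mono : ∀ {I J} → I ⊆ J → ∀ x → nbrsIn I x ≤ nbrsIn J x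
  nbrsIn-mono {I} I⊆J x = p⊆q⇒∣p∣≤∣q∣ λ y∈ →
    let y∈N , y∈I = x∈p∩q⁻ (nbhd G x) I y∈ in x∈p∩q⁺ (y∈N , I⊆J y∈I)

  1≤nbrsIn : ∀ {I x y} → Adj G x y → y ∈ I → 1 ≤ nbrsIn I x
  1≤nbrsIn xy y∈I = x∈p⇒1≤∣p∣ (x∈p∩q⁺ (Adj⇒∈nbhd xy , y∈I))

  2≤nbrsIn : ∀ {I x y z} → y ≢ z → Adj G x y → y ∈ I → Adj G x z → z ∈ I →
    2 ≤ nbrsIn I x
  2≤nbrsIn y≢z xy y∈I xz z∈I = x≢y∈p⇒2≤∣p∣ y≢z
    (x∈p∩q⁺ (Adj⇒∈nbhd xy , y∈I)) (x∈p∩q⁺ (Adj⇒∈nbhd xz , z∈I))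

  1≤nbrsIn⇒nbr : ∀ I x → 1 ≤ nbrsIn I x → ∃[ y ] (Adj G x y × y ∈ I)
  1≤nbrsIn⇒nbr I x 1≤ =
    let y , y∈ = 1≤∣p∣⇒nonempty (nbhd G x ∩ I) 1≤
        y∈N , y∈I = x∈p∩q⁻ (nbhd G x) I y∈
    in y , ∈nbhd⇒Adj y∈N , y∈I

  nbrsIn-insert-≤ : ∀ I u x → nbrsIn (I ∪ ⁅ u ⁆) x ≤ suc (nbrsIn I x)
  nbrsIn-insert-≤ I u x = begin
    ∣ nbhd G x ∩ (I ∪ ⁅ u ⁆) ∣     ≤⟨ p⊆q⇒∣p∣≤∣q∣ sub ⟩
    ∣ (nbhd G x ∩ I) ∪ ⁅ u ⁆ ∣     ≤⟨ ∣p∪q∣≤∣p∣+∣q∣ (nbhd G x ∩ I) ⁅ u ⁆ ⟩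
    nbrsIn I x + ∣ ⁅ u ⁆ ∣         ≡⟨ cong (nbrsIn I x +_) (∣⁅x⁆∣≡1 u) ⟩
    nbrsIn I x + 1                 ≡⟨ +-comm (nbrsIn I x) 1 ⟩
    suc (nbrsIn I x)               ∎
    where
    open ≤-Reasoning
    sub : nbhd G x ∩ (I ∪ ⁅ u ⁆) ⊆ (nbhd G x ∩ I) ∪ ⁅ u ⁆
    sub y∈ with x∈p∩q⁻ (nbhd G x) (I ∪ ⁅ u ⁆) y∈
    ... | y∈N , y∈I∪u with x∈p∪q⁻ I ⁅ u ⁆ y∈I∪u
    ...   | inj₁ y∈I = x∈p∪q⁺ (inj₁ (x∈p∩q⁺ (y∈N , y∈I)))
    ...   | inj₂ y∈u = x∈p∪q⁺ (inj₂ y∈u)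

  nbrsIn-insert-nonadj : ∀ I u x → ¬ Adj G x u →
    nbrsIn (I ∪ ⁅ u ⁆) x ≤ nbrsIn I x
  nbrsIn-insert-nonadj I u x ¬xu = p⊆q⇒∣p∣≤∣q∣ sub
    where
    sub : nbhd G x ∩ (I ∪ ⁅ u ⁆) ⊆ nbhd G x ∩ I
    sub y∈ with x∈p∩q⁻ (nbhd G x) (I ∪ ⁅ u ⁆) y∈
    ... | y∈N , y∈I∪u with x∈p∪q⁻ I ⁅ u ⁆ y∈I∪u
    ...   | inj₁ y∈I = x∈p∩q⁺ (y∈N , y∈I)
    ...   | inj₂ y∈u with x∈⁅y⁆⇒x≡y u y∈u
    ...     | refl = contradiction (∈nbhd⇒Adj y∈N) ¬xu

  Independent : Subset n → Set
  Independent I = ∀ u v → Adj G u v → u ∈ I → v ∉ I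

  ¬Adj-insert : ∀ {I u} → nbrsIn I u ≡ 0 → ∀ {x} → x ∈ I ∪ ⁅ u ⁆ → ¬ Adj G u x
  ¬Adj-insert {I} {u} k≡0 x∈ ux with x∈p∪q⁻ I ⁅ u ⁆ x∈
  ... | inj₁ x∈I = <⇒≢ (1≤nbrsIn ux x∈I) (≡-sym k≡0)
  ... | inj₂ x∈u = Adj⇒≢ ux (≡-sym (x∈⁅y⁆⇒x≡y u x∈u))

  independent-insert : ∀ {I u} → Independent I → nbrsIn I u ≡ 0 → Independent (I ∪ ⁅ u ⁆)
  independent-insert {I} {u} ind k≡0 x y xy x∈ y∈
    with x∈p∪q⁻ I ⁅ u ⁆ x∈ | x∈p∪q⁻ I ⁅ u ⁆ y∈
  ... | inj₁ x∈I | inj₁ y∈I = ind x y xy x∈I y∈I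
  ... | inj₂ x∈u | _ with x∈⁅y⁆⇒x≡y u x∈u
  ...   | refl = ¬Adj-insert k≡0 y∈ xy
  independent-insert {I} {u} ind k≡0 x y xy x∈ y∈
      | inj₁ x∈I | inj₂ y∈u with x∈⁅y⁆⇒x≡y u y∈u
  ...   | refl = ¬Adj-insert k≡0 x∈ (Adj-sym xy)

  -- Admissible, saturated and supported sets.

  module _ (d : ℕ) where

    -- In a `d`-regular graph the second condition says that every vertex keeps a neighbour in the
    -- complement of `I`.
    Admissible : Subset n → Set
    Admissible I = Independent I × (∀ v → nbrsIn I v < d)

    admissible? : ∀ I → Dec (Admissible I)
    admissible? I =
      all? (λ u → all? λ v → T? (adj G u v) →-dec (u ∈? I →-dec ¬? (v ∈? I)))
      ×-dec all? (λ v → nbrsIn I v <? d)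

    -- For admissible `I` this is equality with `d ∸ 1`; the inequality form makes it monotone in
    -- `I`.
    NearlyFull : Subset n → Fin n → Set
    NearlyFull I v = d ≤ suc (nbrsIn I v)

    -- The obstruction to inserting `w` outside `I`: the neighbourhood of `v` would then be
    -- swallowed.
    Blocked : Subset n → Fin n → Set
    Blocked I w = ∃[ v ] (Adj G w v × NearlyFull I v)

    blocked? : ∀ I w → Dec (Blocked I w)
    blocked? I w = any? λ v → T? (adj G w v) ×-dec (d ≤? suc (nbrsIn I v))

    blocked-mono : ∀ {I J} → I ⊆ J → ∀ {w} → Blocked I w → Blocked J w
    blocked-mono I⊆J (v , wv , full) = v , wv , ≤-trans full (s≤s (nbrsIn-mono I⊆J v))

    -- Only neighbours of `u` gain a neighbour in the set, at most one each, and none of them is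
    -- nearly full.
    admissible-insert : ∀ {I u} → Admissible I → nbrsIn I u ≡ 0 → ¬ Blocked I u →
      Admissible (I ∪ ⁅ u ⁆)
    admissible-insert {I} {u} (ind , k<d) k≡0 ¬bl = independent-insert ind k≡0 , k′<d
      where
      k′<d : ∀ v → nbrsIn (I ∪ ⁅ u ⁆) v < d
      k′<d v with T? (adj G v u)
      ... | no ¬vu = ≤-<-trans (nbrsIn-insert-nonadj I u v ¬vu) (k<d v)
      ... | yes vu = ≤-<-trans (nbrsIn-insert-≤ I u v)
                       (≰⇒> λ full → ¬bl (v , Adj-sym vu , full))

    -- Each alternative yields a neighbour of `t` that will have a positive `charge`, and each is
    -- monotone in `I`.
    Supported : Subset n → Fin n → Set
    Supported I t = (∃[ x ] (Adj G t x × 2 ≤ nbrsIn I x)) ⊎ (∃[ w ] (Adj G t w × Blocked I w))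

    supported? : ∀ I t → Dec (Supported I t)
    supported? I t =
      any? (λ x → T? (adj G t x) ×-dec (2 ≤? nbrsIn I x))
      ⊎-dec any? (λ w → T? (adj G t w) ×-dec blocked? I w)

    supported-mono : ∀ {I J} → I ⊆ J → ∀ {t} → Supported I t → Supported J t
    supported-mono I⊆J (inj₁ (x , tx , 2≤)) = inj₁ (x , tx , ≤-trans 2≤ (nbrsIn-mono I⊆J x))
    supported-mono I⊆J (inj₂ (w , tw , bl)) = inj₂ (w , tw , blocked-mono I⊆J bl)

    Saturated : Subset n → Set
    Saturated I = ∀ u → u ∉ I → nbrsIn I u ≡ 0 → Blocked I u

    complement-isTVC : ∀ {I} → Regular d G → Admissible I → IsTotalVertexCover G (∁ I)
    complement-isTVC {I} reg (ind , k<d) = cover , dominating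
      where
      cover : IsVertexCover G (∁ I)
      cover u v uv with u ∈? I
      ... | yes u∈I = inj₂ (x∉p⇒x∈∁p (ind u v uv u∈I))
      ... | no  u∉I = inj₁ (x∉p⇒x∈∁p u∉I)
      dominating : IsTotalDominating G (∁ I)
      dominating v with any? (λ u → T? (adj G v u) ×-dec (u ∈? ∁ I))
      ... | yes ex = ex
      ... | no ¬ex = contradiction (k<d v) (≤⇒≯ (subst (_≤ nbrsIn I v) (reg v)
              (p⊆q⇒∣p∣≤∣q∣ λ u∈N → x∈p∩q⁺ (u∈N ,
                 x∉∁p⇒x∈p λ u∈∁I → ¬ex (_ , ∈nbhd⇒Adj u∈N , u∈∁I)))))

    saturated-exists : 0 < d → ∃[ I ] (Admissible I × Saturated I)
    saturated-exists 0<d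
      with extendToMaximal Admissible admissible? ⊥
             ((λ _ _ _ u∈⊥ → contradiction u∈⊥ ∉⊥) ,
              λ v → ≤-<-trans (∣p∩q∣≤∣q∣ (nbhd G v) ⊥) (subst (_< d) (≡-sym (∣⊥∣≡0 n)) 0<d))
    ... | I , _ , adm , maximal = I , adm , λ u u∉I k≡0 →
      decidable-stable (blocked? I u) λ ¬bl →
        maximal u u∉I (admissible-insert adm k≡0 ¬bl)

    supportedSaturated-exists : Connected G → 2 < d →
      ∀ {y x z} → Adj G y x → Adj G x z → y ≢ z → ¬ Adj G y z →
      ∃[ I ] (Admissible I × Saturated I × (∀ t → t ∈ I → Supported I t))
    supportedSaturated-exists conn 2<d {y} {x} {z} yx xz y≢z ¬yz
      with extendToMaximal Good good? I₀ (start-admissible , start-supported)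
      where
      Good : Subset n → Set
      Good I = Admissible I × (∀ t → t ∈ I → Supported I t)
      good? : ∀ I → Dec (Good I)
      good? I = admissible? I ×-dec all? λ t → t ∈? I →-dec supported? I t
      I₀ : Subset n
      I₀ = ⁅ y ⁆ ∪ ⁅ z ⁆
      y∈I₀ : y ∈ I₀
      y∈I₀ = p⊆p∪q ⁅ z ⁆ (x∈⁅x⁆ y)
      z∈I₀ : z ∈ I₀
      z∈I₀ = q⊆p∪q ⁅ y ⁆ ⁅ z ⁆ (x∈⁅x⁆ z)
      ∈I₀ : ∀ {t} → t ∈ I₀ → t ≡ y ⊎ t ≡ z
      ∈I₀ = map-⊎ (x∈⁅y⁆⇒x≡y y) (x∈⁅y⁆⇒x≡y z) ∘ x∈p∪q⁻ ⁅ y ⁆ ⁅ z ⁆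
      start-independent : Independent I₀
      start-independent u v uv u∈ v∈ with ∈I₀ u∈ | ∈I₀ v∈
      ... | inj₁ refl | inj₁ refl = Adj⇒≢ uv refl
      ... | inj₁ refl | inj₂ refl = ¬yz uv
      ... | inj₂ refl | inj₁ refl = ¬yz (Adj-sym uv)
      ... | inj₂ refl | inj₂ refl = Adj⇒≢ uv refl
      start-admissible : Admissible I₀
      -- A vertex has at most `∣ I₀ ∣ ≤ 2` neighbours in `I₀`, and `2 < d`.
      start-admissible = start-independent , λ v → ≤-<-trans (∣p∩q∣≤∣q∣ (nbhd G v) I₀)
        (≤-<-trans (∣p∪q∣≤∣p∣+∣q∣ ⁅ y ⁆ ⁅ z ⁆)
          (subst (_< d) (≡-sym (cong₂ _+_ (∣⁅x⁆∣≡1 y) (∣⁅x⁆∣≡1 z))) 2<d))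
      start-supported : ∀ t → t ∈ I₀ → Supported I₀ t
      -- The midpoint `x` sees both `y` and `z`, so it supports both.
      start-supported t t∈ = inj₁ (x , [ (λ { refl → yx }) , (λ { refl → Adj-sym xz }) ]′ (∈I₀ t∈) ,
        2≤nbrsIn y≢z (Adj-sym yx) y∈I₀ xz z∈I₀)
    ... | I , I₀⊆I , (adm , supp) , maximal = I , adm , saturated , supp
      where
      -- Inserting such a `u` keeps the set admissible and all old vertices supported, so maximality
      -- can only fail to be violated because `u` itself would be unsupported.
      insert : ∀ {u} → u ∉ I → nbrsIn I u ≡ 0 → ¬ Blocked I u → ¬ Supported (I ∪ ⁅ u ⁆) u
      insert {u} u∉I k≡0 ¬bl su = maximal u u∉I (admissible-insert adm k≡0 ¬bl , supp′)
        where
        supp′ : ∀ t → t ∈ I ∪ ⁅ u ⁆ → Supported (I ∪ ⁅ u ⁆) t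
        supp′ t t∈ with x∈p∪q⁻ I ⁅ u ⁆ t∈
        ... | inj₁ t∈I = supported-mono (p⊆p∪q ⁅ u ⁆) (supp t t∈I)
        ... | inj₂ t∈u with x∈⁅y⁆⇒x≡y u t∈u
        ...   | refl = su

      Free : Fin n → Set
      Free u = u ∉ I × nbrsIn I u ≡ 0 × ¬ Blocked I u

      -- If `v` had a neighbour `t` in `I`, it would see both `t` and `u` after insertion; if `v`
      -- were blocked, it would still be blocked then. Either way `v` would support `u`.
      free-step : ∀ {u v} → Adj G u v → Free u → Free v
      free-step {u} {v} uv (u∉I , k≡0 , ¬bl) = v∉I , kv≡0 , ¬blv
        where
        u∈I+u : u ∈ I ∪ ⁅ u ⁆
        u∈I+u = q⊆p∪q I ⁅ u ⁆ (x∈⁅x⁆ u)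
        v∉I : v ∉ I
        v∉I v∈I = <⇒≢ (1≤nbrsIn uv v∈I) (≡-sym k≡0)
        kv≡0 : nbrsIn I v ≡ 0
        kv≡0 = decidable-stable (nbrsIn I v ≟ 0) λ kv≢0 →
          let t , vt , t∈I = 1≤nbrsIn⇒nbr I v (n≢0⇒n>0 kv≢0)
          in insert u∉I k≡0 ¬bl (inj₁ (v , uv ,
               2≤nbrsIn (λ { refl → u∉I t∈I }) vt (p⊆p∪q ⁅ u ⁆ t∈I) (Adj-sym uv) u∈I+u))
        ¬blv : ¬ Blocked I v
        ¬blv bl = insert u∉I k≡0 ¬bl (inj₂ (v , uv , blocked-mono (p⊆p∪q ⁅ u ⁆) bl))

      free-reachable : ∀ {u v} → Reachable G u v → Free u → Free v
      free-reachable here        fu = fu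
      free-reachable (step uv r) fu = free-reachable r (free-step uv fu)

      saturated : Saturated I
      saturated u u∉I k≡0 = decidable-stable (blocked? I u) λ ¬bl →
        -- Freeness would spread along a walk to `y`, which lies in `I`.
        proj₁ (free-reachable (conn u y) (u∉I , k≡0 , ¬bl)) (I₀⊆I (p⊆p∪q ⁅ z ⁆ (x∈⁅x⁆ y)))

  -- Without such a path, being equal or adjacent is transitive, so connectedness makes the graph
  -- complete and regularity fixes its order as `suc d`.
  inducedPath-exists : ∀ {d} → Regular d G → Connected G → 0 < n → ¬ IsK (suc d) G →
    ∃[ y ] ∃[ x ] ∃[ z ] (Adj G y x × Adj G x z × y ≢ z × ¬ Adj G y z)
  inducedPath-exists {d} reg conn 0<n ¬K
    with any? (λ y → any? λ x → any? λ z →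
           T? (adj G y x) ×-dec T? (adj G x z) ×-dec ¬? (y ≟ᶠ z) ×-dec ¬? (T? (adj G y z)))
  ... | yes path = path
  ... | no ¬path = contradiction (order 0<n , complete) ¬K
    where
    close : ∀ {u v} → Reachable G u v → u ≡ v ⊎ Adj G u v
    close here = inj₁ refl
    close {u} (step {v = v} {w = w} uv r) with close r
    ... | inj₁ refl = inj₂ uv
    ... | inj₂ vw with u ≟ᶠ w
    ...   | yes u≡w = inj₁ u≡w
    ...   | no  u≢w = inj₂ (decidable-stable (T? (adj G u w)) λ ¬uw →
                        ¬path (u , v , w , uv , vw , u≢w , ¬uw))
    complete : IsComplete G
    complete u v u≢v = [ (λ u≡v → contradiction u≡v u≢v) , (λ uv → uv) ]′ (close (conn u v))
    fromPos : ∀ {m} → 0 < m → Fin m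
    fromPos {suc m} _ = zero
    order : 0 < n → n ≡ suc d
    order 0<n = begin
      n                            ≡⟨ ∣p∣+∣∁p∣≡n ⁅ v ⁆ ⟨
      ∣ ⁅ v ⁆ ∣ + ∣ ∁ ⁅ v ⁆ ∣      ≡⟨ cong₂ _+_ (∣⁅x⁆∣≡1 v) (cong ∣_∣ ∁v≡N) ⟩
      suc (degree G v)             ≡⟨ cong suc (reg v) ⟩
      suc d                        ∎
      where
      open ≡-Reasoning
      v : Fin n
      v = fromPos 0<n
      ∁v≡N : ∁ ⁅ v ⁆ ≡ nbhd G v
      ∁v≡N = ⊆-antisym
        (λ u∈ → Adj⇒∈nbhd (complete v _ λ { refl → x∈∁p⇒x∉p u∈ (x∈⁅x⁆ v) }))
        (λ u∈ → x∉p⇒x∈∁p λ u∈v → Adj⇒≢ (∈nbhd⇒Adj u∈) (≡-sym (x∈⁅y⁆⇒x≡y v u∈v)))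

-- Pointwise inequalities between demands and budgets.

pos : ℕ → ℕ
pos zero    = 0
pos (suc _) = 1

-- With k = k x and h the number of vertices v paying for x, an upper bound on the
-- demand of x ∉ I, and the amount x passes on to each of its neighbours in I.
cover charge : ℕ → ℕ → ℕ
cover zero    h = h
cover (suc _) h = 1
charge zero          h = 0
charge (suc zero)    h = h
charge (suc (suc _)) h = 1

-- The part of charge k h * k + 2 * cover k h not depending on h.
load : ℕ → ℕ
load zero          = 0
load (suc zero)    = 2
load (suc (suc j)) = 4 + j

cover≤ : ∀ k h → cover k h ≤ pos k + h
cover≤ zero    h = ≤-refl
cover≤ (suc k) h = s≤s z≤n

-- Amounts are doubled because a vertex of `I` demands one half: `charge` is in half units and goes
-- to `k` neighbours, while covering a vertex costs two half units.
charge+cover≤ : ∀ k h → charge k h * k + 2 * cover k h ≤ load k + 2 * h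
charge+cover≤ zero          h = ≤-refl
charge+cover≤ (suc zero)    h = begin
  h * 1 + 2     ≡⟨ cong (_+ 2) (*-identityʳ h) ⟩
  h + 2         ≤⟨ +-monoˡ-≤ 2 (m≤m+n h (h + 0)) ⟩
  2 * h + 2     ≡⟨ +-comm (2 * h) 2 ⟩
  2 + 2 * h     ∎
  where open ≤-Reasoning
charge+cover≤ (suc (suc j)) h = begin
  1 * suc (suc j) + 2   ≡⟨ cong (_+ 2) (*-identityˡ (2 + j)) ⟩
  2 + j + 2             ≡⟨ +-comm (2 + j) 2 ⟩
  4 + j                 ≤⟨ m≤m+n (4 + j) (2 * h) ⟩
  4 + j + 2 * h         ∎
  where open ≤-Reasoning

⟦⟧≤1 : ∀ b → ⟦ b ⟧ ≤ 1
⟦⟧≤1 true  = ≤-refl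
⟦⟧≤1 false = z≤n

full : ℕ → ℕ → ℕ
full d k = ⟦ suc k ≡ᵇ d ⟧

-- Here `m` is the number of neighbours outside `I`; it is 1 exactly when `k` is `d ∸ 1`, so a full
-- vertex pays for exactly one vertex.
full*complement : ∀ {d} k m → m + k ≡ d → full d k * m ≡ full d k
full*complement {d} k m m+k≡d with suc k ≡ᵇ d in eq
... | false = refl
... | true  = trans (+-identityʳ m) (+-cancelʳ-≡ k m 1
  (trans m+k≡d (≡-sym (≡ᵇ⇒≡ (suc k) d (subst T (≡-sym eq) tt)))))

-- The bound on `d` makes `full` vanish for `k ≤ 1`; from `k = 2` on, the left side is at most 2.
pos+full≤ : ∀ {d} → 3 ≤ d → ∀ k → pos k + full d k ≤ k
pos+full≤ (s≤s (s≤s (s≤s z≤n))) zero          = z≤n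
pos+full≤ (s≤s (s≤s (s≤s z≤n))) (suc zero)    = ≤-refl
pos+full≤ {d} _                 (suc (suc k)) = s≤s (≤-trans (⟦⟧≤1 (3 + k ≡ᵇ d)) (s≤s z≤n))

-- The slack `2 * k ∸ load k` is 0, 0, 0, 1 for `k` from 0 to 3, too little for an extra payment of
-- 2, but there `5 ≤ d` makes `full` vanish. From `k = 4` on the slack is `k ∸ 2`, at least 2.
load+full≤ : ∀ {d} → 5 ≤ d → ∀ k → load k + 2 * full d k ≤ 2 * k
load+full≤ (s≤s (s≤s (s≤s (s≤s (s≤s z≤n))))) 0 = z≤n
load+full≤ (s≤s (s≤s (s≤s (s≤s (s≤s z≤n))))) 1 = ≤-refl
load+full≤ (s≤s (s≤s (s≤s (s≤s (s≤s z≤n))))) 2 = ≤-refl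
load+full≤ (s≤s (s≤s (s≤s (s≤s (s≤s z≤n))))) 3 = n≤1+n 5
load+full≤ {d} _ (suc (suc (suc (suc j)))) = begin
  6 + j + 2 * ⟦ 5 + j ≡ᵇ d ⟧   ≤⟨ +-monoʳ-≤ (6 + j) (*-monoʳ-≤ 2 (⟦⟧≤1 (5 + j ≡ᵇ d))) ⟩
  6 + j + 2                    ≡⟨ +-comm (6 + j) 2 ⟩
  8 + j                        ≤⟨ m≤m+n (8 + j) j ⟩
  8 + j + j                    ≡⟨ eq j ⟩
  2 * (4 + j)                  ∎
  where
  open ≤-Reasoning
  eq : ∀ j → 8 + j + j ≡ 2 * (4 + j)
  eq = solve-∀

-- Double counting the edges at `I`.

module Counting {n} (G : Graph n) (d : ℕ) (reg : Regular d G) (I : Subset n)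
                (adm : Admissible G d I) (sat : Saturated G d I) where

  private
    ind : Independent G I
    ind = proj₁ adm

    A : Fin n → Fin n → ℕ
    A x y = ⟦ adj G x y ⟧

    a ā k : Fin n → ℕ
    a x = ⟦ lookup I x ⟧
    ā x = ⟦ not (lookup I x) ⟧
    k x = nbrsIn G I x

    -- The factor `ā w` restricts the payments of full vertices to recipients outside `I`.
    h : Fin n → ℕ
    h w = ā w * ∑[ v < n ] (A w v * full d (k v))

    A≡1 : ∀ {x y} → Adj G x y → A x y ≡ 1
    A≡1 = T⇒⟦⟧≡1

  double-count : ∀ (b q : Fin n → ℕ) →
    ∑[ y < n ] (b y * ∑[ x < n ] (A y x * q x)) ≡ ∑[ x < n ] (q x * ∑[ y < n ] (A x y * b y))
  double-count b q = begin
    ∑[ y < n ] (b y * ∑[ x < n ] (A y x * q x))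
      ≡⟨ sum-cong-≗ (λ y → *-distribˡ-sum (b y) (λ x → A y x * q x)) ⟩
    ∑[ y < n ] ∑[ x < n ] (b y * (A y x * q x))
      ≡⟨ ∑-comm (λ y x → b y * (A y x * q x)) ⟩
    ∑[ x < n ] ∑[ y < n ] (b y * (A y x * q x))
      ≡⟨ sum-cong-≗ (λ x → sum-cong-≗ λ y → trans
           (cong (λ e → b y * (⟦ e ⟧ * q x)) (Graph.sym G y x)) (swap (b y) (A x y) (q x))) ⟩
    ∑[ x < n ] ∑[ y < n ] (q x * (A x y * b y))
      ≡⟨ sum-cong-≗ (λ x → *-distribˡ-sum (q x) (λ y → A x y * b y)) ⟨
    ∑[ x < n ] (q x * ∑[ y < n ] (A x y * b y))   ∎
    where
    open ≡-Reasoning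
    swap : ∀ b e q → b * (e * q) ≡ q * (e * b)
    swap = solve-∀

  k≡∑ : ∀ x → k x ≡ ∑[ y < n ] (A x y * a y)
  k≡∑ x = trans (∣p∣≡∑ (nbhd G x ∩ I)) (sum-cong-≗ λ y → begin
    ⟦ lookup (nbhd G x ∩ I) y ⟧           ≡⟨ cong ⟦_⟧ (lookup-zipWith _∧_ y (nbhd G x) I) ⟩
    ⟦ lookup (nbhd G x) y ∧ lookup I y ⟧  ≡⟨ cong (λ b → ⟦ b ∧ lookup I y ⟧) (lookup∘tabulate (adj G x) y) ⟩
    ⟦ adj G x y ∧ lookup I y ⟧            ≡⟨ ⟦∧⟧ (adj G x y) (lookup I y) ⟩
    A x y * a y                           ∎)
    where open ≡-Reasoning

  degree≡∑ : ∀ x → ∑[ y < n ] A x y ≡ d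
  degree≡∑ x = trans (≡-sym (trans (∣p∣≡∑ (nbhd G x))
    (sum-cong-≗ λ y → cong ⟦_⟧ (lookup∘tabulate (adj G x) y)))) (reg x)

  -- Both sides total what `I` receives when each `x` hands `q x` to each of its neighbours in `I`.
  -- It serves for `q` constantly 1 and for `q` the charge.
  ∑a*A≡∑*k : ∀ q → ∑[ t < n ] (a t * ∑[ x < n ] (A t x * q x)) ≡ ∑[ x < n ] (q x * k x)
  ∑a*A≡∑*k q = trans (double-count a q) (sum-cong-≗ λ x → cong (q x *_) (≡-sym (k≡∑ x)))

  ∑k≡∣I∣*d : ∑[ x < n ] k x ≡ d * ∣ I ∣
  ∑k≡∣I∣*d = begin
    ∑[ x < n ] k x                                ≡⟨ sum-cong-≗ (λ x → *-identityˡ (k x)) ⟨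
    ∑[ x < n ] (1 * k x)                          ≡⟨ ∑a*A≡∑*k (const 1) ⟨
    ∑[ t < n ] (a t * ∑[ x < n ] (A t x * 1))     ≡⟨ sum-cong-≗ (λ t → cong (a t *_) (trans
                                                       (sum-cong-≗ λ x → *-identityʳ (A t x)) (degree≡∑ t))) ⟩
    ∑[ t < n ] (a t * d)                          ≡⟨ sum-cong-≗ (λ t → *-comm (a t) d) ⟩
    ∑[ t < n ] (d * a t)                          ≡⟨ *-distribˡ-sum d a ⟨
    d * ∑[ t < n ] a t                            ≡⟨ cong (d *_) (∣p∣≡∑ I) ⟨
    d * ∣ I ∣                                     ∎
    where open ≡-Reasoning

  outside+k≡d : ∀ x → ∑[ y < n ] (A x y * ā y) + k x ≡ d
  outside+k≡d x = begin
    ∑[ y < n ] (A x y * ā y) + k x                       ≡⟨ cong (∑[ y < n ] (A x y * ā y) +_) (k≡∑ x) ⟩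
    ∑[ y < n ] (A x y * ā y) + ∑[ y < n ] (A x y * a y)  ≡⟨ ∑-distrib-+ (λ y → A x y * ā y) (λ y → A x y * a y) ⟨
    ∑[ y < n ] (A x y * ā y + A x y * a y)               ≡⟨ sum-cong-≗ (λ y → split (A x y) (lookup I y)) ⟩
    ∑[ y < n ] A x y                                     ≡⟨ degree≡∑ x ⟩
    d                                                    ∎
    where
    open ≡-Reasoning
    split : ∀ e b → e * ⟦ not b ⟧ + e * ⟦ b ⟧ ≡ e
    split e b = trans (≡-sym (*-distribˡ-+ e ⟦ not b ⟧ ⟦ b ⟧)) (trans (cong (e *_) (one b)) (*-identityʳ e))
      where
      one : ∀ b → ⟦ not b ⟧ + ⟦ b ⟧ ≡ 1
      one true  = refl
      one false = refl

  -- Each full vertex has exactly one neighbour outside `I`, so it is counted once on the left.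
  ∑h≡∑full : ∑[ w < n ] h w ≡ ∑[ v < n ] full d (k v)
  ∑h≡∑full = trans (double-count ā (full d ∘ k))
    (sum-cong-≗ λ v → full*complement (k v) _ (outside+k≡d v))

  -- Moves payments from recipients back to payers, after which only a pointwise inequality in `k x`
  -- remains.
  ∑-scaled-h : ∀ c (f : Fin n → ℕ) →
    ∑[ x < n ] (f x + c * h x) ≡ ∑[ x < n ] (f x + c * full d (k x))
  ∑-scaled-h c f = begin
    ∑[ x < n ] (f x + c * h x)                           ≡⟨ ∑-distrib-+ f (λ x → c * h x) ⟩
    sum f + ∑[ x < n ] (c * h x)                         ≡⟨ cong (sum f +_) (*-distribˡ-sum c h) ⟨
    sum f + c * ∑[ x < n ] h x                           ≡⟨ cong (λ s → sum f + c * s) ∑h≡∑full ⟩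
    sum f + c * ∑[ x < n ] full d (k x)                  ≡⟨ cong (sum f +_) (*-distribˡ-sum c (full d ∘ k)) ⟩
    sum f + ∑[ x < n ] (c * full d (k x))                ≡⟨ ∑-distrib-+ f (λ x → c * full d (k x)) ⟨
    ∑[ x < n ] (f x + c * full d (k x))                  ∎
    where open ≡-Reasoning

  blocked⇒1≤h : ∀ {w} → w ∉ I → Blocked G d I w → 1 ≤ h w
  blocked⇒1≤h {w} w∉I (v , wv , nearlyFull) = begin
    1                                          ≡⟨ cong₂ _*_ (A≡1 wv) full≡1 ⟨
    A w v * full d (k v)                       ≤⟨ term≤∑ (λ v → A w v * full d (k v)) v ⟩
    ∑[ v < n ] (A w v * full d (k v))          ≡⟨ *-identityˡ _ ⟨
    1 * ∑[ v < n ] (A w v * full d (k v))      ≡⟨ cong (_* ∑[ v < n ] (A w v * full d (k v))) ā≡1 ⟨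
    h w                                        ∎
    where
    open ≤-Reasoning
    full≡1 : full d (k v) ≡ 1
    -- Admissibility turns the inequality of `NearlyFull` into equality.
    full≡1 = T⇒⟦⟧≡1 (≡⇒≡ᵇ (suc (k v)) d (≤-antisym (proj₂ adm v) nearlyFull))
    ā≡1 : ā w ≡ 1
    ā≡1 with lookup I w in eq
    ... | true  = contradiction (lookup⇒[]= w I eq) w∉I
    ... | false = refl

  -- Outside `I`, a dominated vertex has cover 1, and an undominated one is blocked by saturation,
  -- so somebody pays for it.
  ā≤cover : ∀ x → ā x ≤ cover (k x) (h x)
  ā≤cover x with x ∈? I
  ... | yes x∈I = ≤-trans (≤-reflexive (cong (⟦_⟧ ∘ not) ([]=⇒lookup x∈I))) z≤n
  ... | no  x∉I = ≤-trans (⟦⟧≤1 (not (lookup I x))) (1≤cover (k x) refl)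
    where
    1≤cover : ∀ j → k x ≡ j → 1 ≤ cover j (h x)
    1≤cover zero    kx≡0 = blocked⇒1≤h x∉I (sat x x∉I kx≡0)
    1≤cover (suc _) _    = ≤-refl

  ∣∁I∣≤d*∣I∣ : 3 ≤ d → ∣ ∁ I ∣ ≤ d * ∣ I ∣
  ∣∁I∣≤d*∣I∣ 3≤d = begin
    ∣ ∁ I ∣                                   ≡⟨ ∣∁p∣≡∑ I ⟩
    ∑[ x < n ] ā x                            ≤⟨ ∑-mono-≤ (λ x → ≤-trans (ā≤cover x) (≤-trans
                                                   (cover≤ (k x) (h x))
                                                   (+-monoʳ-≤ (pos (k x)) (≤-reflexive (≡-sym (*-identityˡ (h x))))))) ⟩
    ∑[ x < n ] (pos (k x) + 1 * h x)          ≡⟨ ∑-scaled-h 1 (pos ∘ k) ⟩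
    ∑[ x < n ] (pos (k x) + 1 * full d (k x)) ≤⟨ ∑-mono-≤ (λ x → ≤-trans
                                                   (+-monoʳ-≤ (pos (k x)) (≤-reflexive (*-identityˡ (full d (k x)))))
                                                   (pos+full≤ 3≤d (k x))) ⟩
    ∑[ x < n ] k x                            ≡⟨ ∑k≡∣I∣*d ⟩
    d * ∣ I ∣                                 ∎
    where open ≤-Reasoning

  module _ (supp : ∀ t → t ∈ I → Supported G d I t) where

    received : Fin n → ℕ
    received t = ∑[ x < n ] (A t x * charge (k x) (h x))

    1≤received : ∀ {t x} → Adj G t x → 1 ≤ charge (k x) (h x) → 1 ≤ received t
    1≤received {t} {x} tx 1≤ = begin
      1                              ≤⟨ 1≤ ⟩
      charge (k x) (h x)             ≡⟨ *-identityˡ _ ⟨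
      1 * charge (k x) (h x)         ≡⟨ cong (_* charge (k x) (h x)) (A≡1 tx) ⟨
      A t x * charge (k x) (h x)     ≤⟨ term≤∑ (λ x → A t x * charge (k x) (h x)) x ⟩
      received t                     ∎
      where open ≤-Reasoning

    -- In the second case `w` has the neighbour `t` in `I`, so `k w` is positive; if it is 1, the
    -- charge is `h w`, which is positive because `w` is blocked.
    supported⇒1≤received : ∀ {t} → t ∈ I → Supported G d I t → 1 ≤ received t
    supported⇒1≤received t∈I (inj₁ (x , tx , 2≤k)) = 1≤received tx (1≤charge 2≤k)
      where
      1≤charge : ∀ {j m} → 2 ≤ j → 1 ≤ charge j m
      1≤charge (s≤s (s≤s _)) = ≤-refl
    supported⇒1≤received {t} t∈I (inj₂ (w , tw , bl)) =
      1≤received tw (1≤charge (1≤nbrsIn G (Adj-sym G tw) t∈I)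
        (blocked⇒1≤h (ind t w tw t∈I) bl))
      where
      1≤charge : ∀ {j m} → 1 ≤ j → 1 ≤ m → 1 ≤ charge j m
      1≤charge {suc zero}    _ 1≤m = 1≤m
      1≤charge {suc (suc _)} _ _   = ≤-refl

    a≤a*received : ∀ t → a t ≤ a t * received t
    a≤a*received t with lookup I t in eq
    ... | false = z≤n
    ... | true  = ≤-trans (supported⇒1≤received t∈I (supp t t∈I)) (≤-reflexive (≡-sym (*-identityˡ _)))
      where
      t∈I : t ∈ I
      t∈I = lookup⇒[]= t I eq

    ∣I∣+2*∣∁I∣≤2*d*∣I∣ : 5 ≤ d → ∣ I ∣ + 2 * ∣ ∁ I ∣ ≤ 2 * (d * ∣ I ∣)
    ∣I∣+2*∣∁I∣≤2*d*∣I∣ 5≤d = begin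
      ∣ I ∣ + 2 * ∣ ∁ I ∣
        ≡⟨ cong₂ (λ p q → p + 2 * q) (∣p∣≡∑ I) (∣∁p∣≡∑ I) ⟩
      sum a + 2 * sum ā
        ≤⟨ +-mono-≤ (∑-mono-≤ a≤a*received) (*-monoʳ-≤ 2 (∑-mono-≤ ā≤cover)) ⟩
      ∑[ t < n ] (a t * received t) + 2 * ∑[ x < n ] cover (k x) (h x)
        ≡⟨ cong₂ _+_ (∑a*A≡∑*k (λ x → charge (k x) (h x)))
                     (*-distribˡ-sum 2 (λ x → cover (k x) (h x))) ⟩
      ∑[ x < n ] (charge (k x) (h x) * k x) + ∑[ x < n ] (2 * cover (k x) (h x))
        ≡⟨ ∑-distrib-+ (λ x → charge (k x) (h x) * k x) (λ x → 2 * cover (k x) (h x)) ⟨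
      ∑[ x < n ] (charge (k x) (h x) * k x + 2 * cover (k x) (h x))
        ≤⟨ ∑-mono-≤ (λ x → charge+cover≤ (k x) (h x)) ⟩
      ∑[ x < n ] (load (k x) + 2 * h x)
        ≡⟨ ∑-scaled-h 2 (load ∘ k) ⟩
      ∑[ x < n ] (load (k x) + 2 * full d (k x))
        ≤⟨ ∑-mono-≤ (λ x → load+full≤ 5≤d (k x)) ⟩
      ∑[ x < n ] (2 * k x)
        ≡⟨ *-distribˡ-sum 2 k ⟨
      2 * ∑[ x < n ] k x
        ≡⟨ cong (2 *_) ∑k≡∣I∣*d ⟩
      2 * (d * ∣ I ∣)   ∎
      where open ≤-Reasoning

-- Conversion to the stated ratios, with `i` and `c` the sizes of `I` and its complement.

bound₁ : ∀ d i c → c ≤ d * i → suc d * c ≤ d * (i + c)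
bound₁ d i c c≤di = begin
  suc d * c       ≤⟨ +-monoˡ-≤ (d * c) c≤di ⟩
  d * i + d * c   ≡⟨ *-distribˡ-+ d i c ⟨
  d * (i + c)     ∎
  where open ≤-Reasoning

-- With `ε = 1/(2d+1)` the ratio `(d - ε)/(d + 1)` is `(d(2d+1) - 1)/((d+1)(2d+1))`.
bound₂ : ∀ d i c → i + 2 * c ≤ 2 * (d * i) →
  suc d * suc (2 * d) * c ≤ (d * suc (2 * d) ∸ 1) * (i + c)
bound₂ d i c le = begin
  suc d * suc (2 * d) * c
    ≤⟨ m+n≤o⇒m≤o∸n _ (+-cancelʳ-≤ (d * i) _ _ raised) ⟩
  d * suc (2 * d) * (i + c) ∸ (i + c)
    ≡⟨ cong (d * suc (2 * d) * (i + c) ∸_) (*-identityˡ (i + c)) ⟨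
  d * suc (2 * d) * (i + c) ∸ 1 * (i + c)
    ≡⟨ *-distribʳ-∸ (i + c) (d * suc (2 * d)) 1 ⟨
  (d * suc (2 * d) ∸ 1) * (i + c)   ∎
  where
  open ≤-Reasoning
  lhs : ∀ d i c → suc d * suc (2 * d) * c + (i + c) + d * i
                ≡ suc d * (i + 2 * c) + d * suc (2 * d) * c
  lhs = solve-∀
  rhs : ∀ d i c → suc d * (2 * (d * i)) + d * suc (2 * d) * c
                ≡ d * suc (2 * d) * (i + c) + d * i
  rhs = solve-∀
  -- This is `suc d` times the hypothesis, plus `d * suc (2 * d) * c` on both sides, arranged free
  -- of subtraction.
  raised : suc d * suc (2 * d) * c + (i + c) + d * i ≤ d * suc (2 * d) * (i + c) + d * i
  raised = begin
    suc d * suc (2 * d) * c + (i + c) + d * i          ≡⟨ lhs d i c ⟩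
    suc d * (i + 2 * c) + d * suc (2 * d) * c          ≤⟨ +-monoˡ-≤ _ (*-monoʳ-≤ (suc d) le) ⟩
    suc d * (2 * (d * i)) + d * suc (2 * d) * c        ≡⟨ rhs d i c ⟩
    d * suc (2 * d) * (i + c) + d * i                  ∎

totalVertexCover-regular : (d n : ℕ) → 3 ≤ d → (G : Graph n) → Regular d G →
  ∃[ S ] (IsTotalVertexCover G S × suc d * ∣ S ∣ ≤ d * n)
totalVertexCover-regular d n 3≤d G reg =
  let I , adm , sat = saturated-exists G d (≤-trans (s≤s z≤n) 3≤d)
  in ∁ I , complement-isTVC G d reg adm ,
     subst (λ m → suc d * ∣ ∁ I ∣ ≤ d * m) (∣p∣+∣∁p∣≡n I)
       (bound₁ d ∣ I ∣ ∣ ∁ I ∣ (Counting.∣∁I∣≤d*∣I∣ G d reg I adm sat 3≤d))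

totalVertexCover-connected : (d n : ℕ) → 5 ≤ d → (G : Graph n) → Regular d G → Connected G →
  ¬ IsK (suc d) G →
  ∃[ S ] (IsTotalVertexCover G S × suc d * suc (2 * d) * ∣ S ∣ ≤ (d * suc (2 * d) ∸ 1) * n)
-- The graph without vertices is connected here and has no induced path to start from; the empty set
-- serves.
totalVertexCover-connected d zero 5≤d G _ _ _ =
  [] , ((λ ()) , (λ ())) , ≤-trans (≤-reflexive (*-zeroʳ (suc d * suc (2 * d)))) z≤n
totalVertexCover-connected d n@(suc _) 5≤d G reg conn ¬K =
  let y , x , z , yx , xz , y≢z , ¬yz = inducedPath-exists G reg conn (s≤s z≤n) ¬K
      I , adm , sat , supp = supportedSaturated-exists G d conn
        (≤-trans (s≤s (s≤s (s≤s z≤n))) 5≤d) yx xz y≢z ¬yz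
  in ∁ I , complement-isTVC G d reg adm ,
     subst (λ m → suc d * suc (2 * d) * ∣ ∁ I ∣ ≤ (d * suc (2 * d) ∸ 1) * m) (∣p∣+∣∁p∣≡n I)
       (bound₂ d ∣ I ∣ ∣ ∁ I ∣ (Counting.∣I∣+2*∣∁I∣≤2*d*∣I∣ G d reg I adm sat supp 5≤d))

theorem1p7 : ((d n : ℕ) → 3 ≤ d → (G : Graph n) → Regular d G →
    ∃[ S ] (IsTotalVertexCover G S × (suc d) * ∣ S ∣ ≤ d * n))
    × ((d n : ℕ) → 5 ≤ d → (G : Graph n) → Regular d G → Connected G →
    ¬ IsK (suc d) G →
    ∃[ S ] (IsTotalVertexCover G S ×
    (suc d) * (suc (2 * d)) * ∣ S ∣ ≤ (d * suc (2 * d) ∸ 1) * n))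
theorem1p7 = totalVertexCover-regular , totalVertexCover-connected
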